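{- Every graph $G$ of stability at most two is b-monotonic; that is, $\chi_b(H_1) \geq \chi_b(H_2)$ for every induced subgraph $H_1$ of $G$ and every induced subgraph $H_2$ of $H_1$.
   Context: Graphs are finite and simple. The stability of a graph is the maximum cardinality of a set of pairwise non-adjacent vertices. A b-coloring of a graph with $t$ colors is a proper coloring of the vertices with $t$ colors such that every color class contains a vertex that is adjacent to all other $t-1$ color classes. The b-chromatic number $\chi_b(G)$ is the maximum $t$ such that $G$ admits a b-coloring with $t$ colors. -}

module Defs where

open import Data.Empty using () renaming (⊥ to Empty)
open import Data.Fin.Base using (Fin; zero; suc; punchOut; finToFun; funToFin)
open import Data.Fin.Properties
  using (_≟_; all?; any?; ¬∀⟶∃¬; injective⇒≤; punchOut-injective; finToFun-funToFin; suc-injective)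
open import Data.Fin.Subset using (Subset; inside; outside; _∈_; ∣_∣; ⊥)
open import Data.Fin.Subset.Properties using (_∈?_; anySubset?; ∣p∣≤n; ∉⊥)
open import Data.Nat.Base using (ℕ; zero; suc; _≤_; _≥_; z≤n)
import Data.Nat.Properties as ℕ
open import Data.Product.Base using (∃; _×_; _,_; proj₁; proj₂)
open import Data.Vec.Base using ([]; _∷_; here; there)
open import Function.Base using (id; _∘_; _on_)
open import Function.Definitions using (Injective)
open import Level using (0ℓ)
open import Relation.Binary.Core using (Rel)
open import Relation.Binary.Definitions using (Symmetric; Irreflexive) renaming (Decidable to Decidable₂)
open import Relation.Binary.PropositionalEquality
  using (_≡_; _≢_; _≗_; refl; sym; trans; cong)
open import Relation.Nullary
  using (¬_; Dec; yes; no; contradiction; ¬?; _×-dec_; _→-dec_)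
open import Relation.Nullary.Decidable using (map′)
open import Relation.Unary using (Pred; Decidable)

IsMaximum : Pred ℕ 0ℓ → ℕ → Set
IsMaximum P m = P m × (∀ k → P k → k ≤ m)

maximum : {P : Pred ℕ 0ℓ} → Decidable P → (b : ℕ) → (∀ k → P k → k ≤ b) →
          ∃ P → ∃ (IsMaximum P)
maximum P? zero bound (k , Pk) with bound k Pk
... | z≤n = 0 , Pk , bound
maximum {P} P? (suc b) bound ne with P? (suc b)
... | yes Pb = suc b , Pb , bound
... | no ¬Pb = maximum P? b bound′ ne
  where
  bound′ : ∀ k → P k → k ≤ b
  bound′ k Pk = ℕ.≤-pred (ℕ.≤∧≢⇒< (bound k Pk) λ { refl → ¬Pb Pk })

record Graph (n : ℕ) : Set₁ where
  field
    Adj    : Rel (Fin n) 0ℓ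
    adj?   : Decidable₂ Adj
    symm   : Symmetric Adj
    irrefl : Irreflexive _≡_ Adj

open Graph public

private
  variable
    n t : ℕ

-- The elements of S in increasing order: the vertex i of the subgraph
-- induced by S stands for the vertex `element S i` of the whole graph.
element : (S : Subset n) → Fin ∣ S ∣ → Fin n
element (inside  ∷ S) zero    = zero
element (inside  ∷ S) (suc i) = suc (element S i)
element (outside ∷ S) i       = suc (element S i)

element-injective : (S : Subset n) → Injective _≡_ _≡_ (element S)
element-injective (inside  ∷ S) {zero}  {zero}  eq = refl
element-injective (inside  ∷ S) {suc i} {suc j} eq =
  cong suc (element-injective S (suc-injective eq))
element-injective (outside ∷ S) eq = element-injective S (suc-injective eq)

element-∈ : (S : Subset n) (i : Fin ∣ S ∣) → element S i ∈ S
element-∈ (inside  ∷ S) zero    = here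
element-∈ (inside  ∷ S) (suc i) = there (element-∈ S i)
element-∈ (outside ∷ S) i       = there (element-∈ S i)

element-surjective : (S : Subset n) {v : Fin n} → v ∈ S → ∃ λ i → element S i ≡ v
element-surjective (inside  ∷ S) here = zero , refl
element-surjective (inside  ∷ S) (there v∈S) with element-surjective S v∈S
... | i , refl = suc i , refl
element-surjective (outside ∷ S) (there v∈S) with element-surjective S v∈S
... | i , refl = i , refl

infixl 9 _[_]

_[_] : Graph n → (S : Subset n) → Graph ∣ S ∣
G [ S ] = record
  { Adj    = Adj G on element S
  ; adj?   = λ i j → adj? G (element S i) (element S j)
  ; symm   = symm G
  ; irrefl = λ i≡j → irrefl G (cong (element S) i≡j)
  }

IsStable : Graph n → Subset n → Set
IsStable G S = ∀ u v → u ∈ S → v ∈ S → ¬ Adj G u v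

HasStableSet : Graph n → ℕ → Set
HasStableSet G k = ∃ λ S → IsStable G S × ∣ S ∣ ≡ k

hasStableSet? : (G : Graph n) → Decidable (HasStableSet G)
hasStableSet? G k = anySubset? λ S →
  (all? λ u → all? λ v → (u ∈? S) →-dec ((v ∈? S) →-dec ¬? (adj? G u v)))
  ×-dec (∣ S ∣ ℕ.≟ k)

stability-maximum : (G : Graph n) → ∃ (IsMaximum (HasStableSet G))
stability-maximum {n} G = maximum (hasStableSet? G) n
  (λ { _ (S , _ , refl) → ∣p∣≤n S })
  (_ , ⊥ , (λ _ _ u∈⊥ → contradiction u∈⊥ ∉⊥) , refl)

stability : Graph n → ℕ
stability G = proj₁ (stability-maximum G)

IsProper : Graph n → (Fin n → Fin t) → Set
IsProper G c = ∀ u v → Adj G u v → c u ≢ c v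

IsBVertex : Graph n → (Fin n → Fin t) → Fin n → Set
IsBVertex G c v = ∀ d → d ≢ c v → ∃ λ u → Adj G v u × c u ≡ d

IsBColoring : Graph n → (Fin n → Fin t) → Set
IsBColoring G c = IsProper G c × (∀ k → ∃ λ v → c v ≡ k × IsBVertex G c v)

HasBColoring : Graph n → ℕ → Set
HasBColoring {n} G t = ∃ λ (c : Fin n → Fin t) → IsBColoring G c

isBVertex? : (G : Graph n) (c : Fin n → Fin t) → Decidable (IsBVertex G c)
isBVertex? G c v = all? λ d →
  ¬? (d ≟ c v) →-dec any? λ u → adj? G v u ×-dec (c u ≟ d)

isBColoring? : (G : Graph n) (c : Fin n → Fin t) → Dec (IsBColoring G c)
isBColoring? G c =
  (all? λ u → all? λ v → adj? G u v →-dec ¬? (c u ≟ c v))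
  ×-dec (all? λ k → any? λ v → (c v ≟ k) ×-dec isBVertex? G c v)

isBColoring-resp-≗ : (G : Graph n) {c c′ : Fin n → Fin t} → c ≗ c′ →
                     IsBColoring G c → IsBColoring G c′
isBColoring-resp-≗ G eq (proper , b) =
  (λ u v uv c′u≡c′v → proper u v uv (trans (eq u) (trans c′u≡c′v (sym (eq v))))) ,
  λ k → let (v , cv≡k , bv) = b k in
    v , trans (sym (eq v)) cv≡k , λ d d≢c′v →
      let (u , vu , cu≡d) = bv d (λ d≡cv → d≢c′v (trans d≡cv (eq v)))
      in  u , vu , trans (sym (eq u)) cu≡d

hasBColoring? : (G : Graph n) → Decidable (HasBColoring G)
hasBColoring? {n} G t = map′
  (λ (i , b) → finToFun i , b)
  (λ (c , b) → funToFin c , isBColoring-resp-≗ G (sym ∘ finToFun-funToFin c) b)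
  (any? λ i → isBColoring? G (finToFun {t} {n} i))

hasBColoring⇒≤ : (G : Graph n) → ∀ t → HasBColoring G t → t ≤ n
hasBColoring⇒≤ G t (c , _ , b) = injective⇒≤ {f = proj₁ ∘ b} λ {k} {l} eq →
  trans (sym (proj₁ (proj₂ (b k)))) (trans (cong c eq) (proj₁ (proj₂ (b l))))

-- A color class without a b-vertex can be eliminated: each of its
-- vertices can be given some other color missing from its neighborhood.
proper⇒hasBColoring : (G : Graph n) (c : Fin n → Fin t) → IsProper G c →
                      ∃ (HasBColoring G)
proper⇒hasBColoring {t = zero} G c proper = 0 , c , proper , λ ()
proper⇒hasBColoring {n} {suc t} G c proper
  with all? (λ k → any? λ v → (c v ≟ k) ×-dec isBVertex? G c v)
... | yes b = suc t , c , proper , b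
... | no ¬b with ¬∀⟶∃¬ _ _ (λ k → any? λ v → (c v ≟ k) ×-dec isBVertex? G c v) ¬b
...   | k , ¬bk = proper⇒hasBColoring G c′ proper′
  where
  NewColor : Fin n → Fin (suc t) → Set
  NewColor v d = k ≢ d × (c v ≢ k → d ≡ c v) × (c v ≡ k → ∀ u → Adj G v u → c u ≢ d)

  newColor : ∀ v → ∃ (NewColor v)
  newColor v with c v ≟ k
  ... | no cv≢k = c v , (λ k≡cv → cv≢k (sym k≡cv)) , (λ _ → refl) ,
                  (λ cv≡k → contradiction cv≡k cv≢k)
  ... | yes cv≡k
    with ¬∀⟶∃¬ _ _ (λ d → ¬? (d ≟ c v) →-dec any? λ u → adj? G v u ×-dec (c u ≟ d))
               (λ bv → ¬bk (v , cv≡k , bv))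
  ...   | d , ¬bd = d ,
          (λ k≡d → ¬bd λ d≢cv → contradiction (trans (sym k≡d) (sym cv≡k)) d≢cv) ,
          (λ cv≢k → contradiction cv≡k cv≢k) ,
          (λ _ u vu cu≡d → ¬bd λ _ → u , vu , cu≡d)

  new : Fin n → Fin (suc t)
  new v = proj₁ (newColor v)

  k≢new : ∀ v → k ≢ new v
  k≢new v = proj₁ (proj₂ (newColor v))

  new-keeps : ∀ v → c v ≢ k → new v ≡ c v
  new-keeps v = proj₁ (proj₂ (proj₂ (newColor v)))

  new-avoids : ∀ v → c v ≡ k → ∀ u → Adj G v u → c u ≢ new v
  new-avoids v = proj₂ (proj₂ (proj₂ (newColor v)))

  c′ : Fin n → Fin t
  c′ v = punchOut (k≢new v)

  new-proper : IsProper G new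
  new-proper u v uv eq = cases (c u ≟ k) (c v ≟ k)
    where
    cases : Dec (c u ≡ k) → Dec (c v ≡ k) → Empty
    cases (yes cu≡k) (yes cv≡k) = proper u v uv (trans cu≡k (sym cv≡k))
    cases (yes cu≡k) (no cv≢k)  =
      new-avoids u cu≡k v uv (trans (sym (new-keeps v cv≢k)) (sym eq))
    cases (no cu≢k)  (yes cv≡k) =
      new-avoids v cv≡k u (symm G uv) (trans (sym (new-keeps u cu≢k)) eq)
    cases (no cu≢k)  (no cv≢k)  =
      proper u v uv (trans (sym (new-keeps u cu≢k)) (trans eq (new-keeps v cv≢k)))

  proper′ : IsProper G c′
  proper′ u v uv eq = new-proper u v uv (punchOut-injective (k≢new u) (k≢new v) eq)

χb-maximum : (G : Graph n) → ∃ (IsMaximum (HasBColoring G))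
χb-maximum {n} G = maximum (hasBColoring? G) n (hasBColoring⇒≤ G)
  (proper⇒hasBColoring G id λ u v uv u≡v → irrefl G u≡v uv)

χb : Graph n → ℕ
χb G = proj₁ (χb-maximum G)

IsBMonotonic : Graph n → Set
IsBMonotonic G = ∀ S₁ (S₂ : Subset ∣ S₁ ∣) → χb (G [ S₁ ]) ≥ χb (G [ S₁ ] [ S₂ ])

{-# OPTIONS --safe #-}
-- It suffices to extend a b-coloring of an induced subgraph by one further
-- vertex v without losing colors.
-- (1) If v misses some color, give that color to v.
-- (2) Otherwise, if every class has a b-vertex adjacent to v, make {v} a new
--     class.
-- (3) Otherwise some class k has a b-vertex x not adjacent to v, and a
--     neighbor y of v that is not a b-vertex.  Stability two forces the class
--     to be {x, y}.  If y misses the color d, recolor y with d and give k to v: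
--     x stays a b-vertex, and every other b-vertex that saw k only through y
--     sees one of the nonadjacent vertices x and v.
module Submission where

open import Defs
open import Data.Fin.Base using (Fin; zero; suc)
open import Data.Fin.Properties using (_≟_; all?; any?; ¬∀⟶∃¬; suc-injective)
open import Data.Fin.Subset using (Subset; _∈_; ⁅_⁆; _∪_; _-_; ∣_∣)
open import Data.Fin.Subset.Properties
  using (_∈?_; x∈⁅x⁆; x∈⁅y⁆⇒x≡y; x∈p∪q⁺; x∈p∪q⁻; x∈p∧x≢y⇒x∈p-y; x∈p⇒∣p-x∣<∣p∣)
open import Data.List.Base using (List; []; _∷_; allFin)
open import Data.List.Membership.Propositional using () renaming (_∈_ to _∈ˡ_)
open import Data.List.Membership.Propositional.Properties using (∈-allFin)
open import Data.List.Relation.Unary.Any using (here; there)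
open import Data.Maybe.Base using (Maybe; just; nothing; map)
open import Data.Maybe.Properties using (just-injective; ≡-dec; map-just)
open import Data.Nat.Base using (ℕ; _≤_; _<_; z≤n)
open import Data.Nat.Properties using (≤-refl; ≤-trans; n≤1+n; <⇒≱; ≤-<-trans)
open import Data.Product.Base using (∃; _×_; _,_; proj₁; proj₂)
open import Data.Sum.Base using (_⊎_; inj₁; inj₂)
open import Data.Vec.Functional using (updateAt)
open import Data.Vec.Functional.Properties using (updateAt-updates; updateAt-minimal)
open import Function.Base using (_∘_; const)
open import Relation.Binary.PropositionalEquality
  using (_≡_; _≢_; refl; sym; trans; cong)
open import Relation.Nullary
  using (¬_; Dec; yes; no; contradiction; ¬?; _×-dec_; _→-dec_)
open import Relation.Nullary.Decidable using (decidable-stable)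

private
  variable
    n t : ℕ

-- Stability at most two as a condition on triples.

NoStableTriple : Graph n → Set
NoStableTriple G = ∀ {x y z} → x ≢ y → x ≢ z → y ≢ z →
                   ¬ Adj G x y → ¬ Adj G x z → Adj G y z

-- If `y` and `z` were nonadjacent too, the three vertices would form a stable set of size at least
-- three. Since adjacency is decidable, this refutation yields an actual edge, which the swap below
-- uses to reach a color.
stability≤2⇒noStableTriple : (G : Graph n) → stability G ≤ 2 → NoStableTriple G
stability≤2⇒noStableTriple G α≤2 {x} {y} {z} x≢y x≢z y≢z ¬xy ¬xz =
  decidable-stable (adj? G y z) λ ¬yz →
    <⇒≱ 2<∣T∣ (≤-trans (proj₂ (proj₂ (stability-maximum G)) _ (T , stable ¬yz , refl)) α≤2)
  where
  T : Subset _
  T = ⁅ x ⁆ ∪ (⁅ y ⁆ ∪ ⁅ z ⁆)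

  x∈T : x ∈ T
  x∈T = x∈p∪q⁺ (inj₁ (x∈⁅x⁆ x))

  y∈T-x : y ∈ T - x
  y∈T-x = x∈p∧x≢y⇒x∈p-y (x∈p∪q⁺ (inj₂ (x∈p∪q⁺ (inj₁ (x∈⁅x⁆ y))))) (x≢y ∘ sym)

  z∈T-x-y : z ∈ T - x - y
  z∈T-x-y = x∈p∧x≢y⇒x∈p-y
    (x∈p∧x≢y⇒x∈p-y (x∈p∪q⁺ (inj₂ (x∈p∪q⁺ {p = ⁅ y ⁆} (inj₂ (x∈⁅x⁆ z))))) (x≢z ∘ sym))
    (y≢z ∘ sym)

  2<∣T∣ : 2 < ∣ T ∣
  -- Deleting `z`, `y` and `x` gives the chain 0 ≤ |T - x - y - z| < |T - x - y| < |T - x| < |T|.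
  2<∣T∣ = ≤-<-trans (≤-<-trans (≤-<-trans z≤n (x∈p⇒∣p-x∣<∣p∣ z∈T-x-y))
                               (x∈p⇒∣p-x∣<∣p∣ y∈T-x))
                    (x∈p⇒∣p-x∣<∣p∣ x∈T)

  ∈T : ∀ {u} → u ∈ T → u ≡ x ⊎ u ≡ y ⊎ u ≡ z
  ∈T u∈T with x∈p∪q⁻ ⁅ x ⁆ _ u∈T
  ... | inj₁ u∈x = inj₁ (x∈⁅y⁆⇒x≡y x u∈x)
  ... | inj₂ u∈yz with x∈p∪q⁻ ⁅ y ⁆ _ u∈yz
  ...   | inj₁ u∈y = inj₂ (inj₁ (x∈⁅y⁆⇒x≡y y u∈y))
  ...   | inj₂ u∈z = inj₂ (inj₂ (x∈⁅y⁆⇒x≡y z u∈z))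

  stable : ¬ Adj G y z → IsStable G T
  stable ¬yz u v u∈T v∈T uv with ∈T u∈T | ∈T v∈T
  ... | inj₁ refl        | inj₁ refl        = irrefl G refl uv
  ... | inj₁ refl        | inj₂ (inj₁ refl) = ¬xy uv
  ... | inj₁ refl        | inj₂ (inj₂ refl) = ¬xz uv
  ... | inj₂ (inj₁ refl) | inj₁ refl        = ¬xy (symm G uv)
  ... | inj₂ (inj₁ refl) | inj₂ (inj₁ refl) = irrefl G refl uv
  ... | inj₂ (inj₁ refl) | inj₂ (inj₂ refl) = ¬yz uv
  ... | inj₂ (inj₂ refl) | inj₁ refl        = ¬xz (symm G uv)
  ... | inj₂ (inj₂ refl) | inj₂ (inj₁ refl) = ¬yz (symm G uv)
  ... | inj₂ (inj₂ refl) | inj₂ (inj₂ refl) = irrefl G refl uv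

noStableTriple-induced : (G : Graph n) (S : Subset n) →
                         NoStableTriple G → NoStableTriple (G [ S ])
noStableTriple-induced G S α≤2 x≢y x≢z y≢z =
  α≤2 (x≢y ∘ element-injective S) (x≢z ∘ element-injective S) (y≢z ∘ element-injective S)

-- Partial b-colorings and the recoloring of one vertex.

PartialColoring : ℕ → ℕ → Set
PartialColoring n t = Fin n → Maybe (Fin t)

Colored : PartialColoring n t → Fin n → Set
Colored c v = ∃ λ k → c v ≡ just k

module _ (G : Graph n) where

  Sees : PartialColoring n t → Fin n → Fin t → Set
  Sees c v k = ∃ λ u → Adj G v u × c u ≡ just k

  sees? : (c : PartialColoring n t) → ∀ v k → Dec (Sees c v k)
  sees? c v k = any? λ u → adj? G v u ×-dec ≡-dec _≟_ (c u) (just k)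

  IsPartialProper : PartialColoring n t → Set
  IsPartialProper c = ∀ {u v k} → Adj G u v → c u ≡ just k → c v ≢ just k

  IsPartialBVertex : PartialColoring n t → Fin n → Fin t → Set
  IsPartialBVertex c v k = c v ≡ just k × ∀ d → d ≢ k → Sees c v d

  isPartialBVertex? : (c : PartialColoring n t) → ∀ v k → Dec (IsPartialBVertex c v k)
  isPartialBVertex? c v k =
    ≡-dec _≟_ (c v) (just k) ×-dec all? λ d → ¬? (d ≟ k) →-dec sees? c v d

  -- Uncolored vertices impose no condition, so this amounts to a b-coloring of the subgraph induced
  -- by the colored vertices. That subgraph can then grow inside the fixed vertex set `Fin n`
  -- without renumbering.
  IsPartialBColoring : PartialColoring n t → Set
  IsPartialBColoring c = IsPartialProper c × (∀ k → ∃ λ v → IsPartialBVertex c v k)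

recolor : PartialColoring n t → Fin n → Fin t → PartialColoring n t
recolor c v k = updateAt c v (const (just k))

module _ (c : PartialColoring n t) (v : Fin n) (k : Fin t) where

  recolor-same : recolor c v k v ≡ just k
  recolor-same = updateAt-updates v c

  recolor-other : ∀ {u m} → u ≢ v → c u ≡ m → recolor c v k u ≡ m
  recolor-other u≢v cu≡m = trans (updateAt-minimal _ v c u≢v) cu≡m

  recolor-other⁻ : ∀ {u m} → u ≢ v → recolor c v k u ≡ m → c u ≡ m
  recolor-other⁻ u≢v eq = trans (sym (updateAt-minimal _ v c u≢v)) eq

  recolor-colored : ∀ {u} → Colored c u → Colored (recolor c v k) u
  recolor-colored {u} (l , cu≡l) with u ≟ v
  ... | yes refl = k , recolor-same
  ... | no u≢v   = l , recolor-other u≢v cu≡l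

  -- Only edges at `v` change, and such an edge is spoiled only if its other end has color `k`.
  recolor-proper : (G : Graph n) → IsPartialProper G c →
                   (∀ {u} → u ≢ v → c u ≡ just k → ¬ Adj G v u) →
                   IsPartialProper G (recolor c v k)
  recolor-proper G proper free {p} {q} pq p≡ q≡ with p ≟ v | q ≟ v
  ... | yes refl | yes refl = irrefl G refl pq
  ... | yes refl | no q≢v   = free q≢v
    (recolor-other⁻ q≢v (trans q≡ (trans (sym p≡) recolor-same))) pq
  ... | no p≢v   | yes refl = free p≢v
    (recolor-other⁻ p≢v (trans p≡ (trans (sym q≡) recolor-same))) (symm G pq)
  ... | no p≢v   | no q≢v   = proper pq (recolor-other⁻ p≢v p≡) (recolor-other⁻ q≢v q≡)

-- Extension by one uncolored vertex.

just≢nothing : {A : Set} {a : A} {m : Maybe A} → m ≡ just a → m ≢ nothing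
just≢nothing refl ()

map-suc⁻ : {m : Maybe (Fin t)} {k : Fin t} → map suc m ≡ just (suc k) → m ≡ just k
map-suc⁻ {m = just l} eq = cong just (suc-injective (just-injective eq))

map-suc≢zero : {m : Maybe (Fin t)} → map suc m ≢ just zero
map-suc≢zero {m = just l}  ()
map-suc≢zero {m = nothing} ()

-- Colored vertices must stay colored but may change their color, because the swap in case (3)
-- recolors one of them.
record Extension (G : Graph n) (c : PartialColoring n t) : Set where
  constructor extension
  field
    {colors}   : ℕ
    coloring   : PartialColoring n colors
    bColoring  : IsPartialBColoring G coloring
    moreColors : t ≤ colors
    extends    : ∀ {u} → Colored c u → Colored coloring u

open Extension

module _ (G : Graph n) (α≤2 : NoStableTriple G)
         (c : PartialColoring n t) (bcol : IsPartialBColoring G c)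
         (v : Fin n) (v-uncolored : c v ≡ nothing) where

  private
    proper : IsPartialProper G c
    proper = proj₁ bcol

    b : Fin t → Fin n
    b k = proj₁ (proj₂ bcol k)

    b-color : ∀ k → c (b k) ≡ just k
    b-color k = proj₁ (proj₂ (proj₂ bcol k))

    b-sees : ∀ k d → d ≢ k → Sees G c (b k) d
    b-sees k = proj₂ (proj₂ (proj₂ bcol k))

    colored≢v : ∀ {u k} → c u ≡ just k → u ≢ v
    colored≢v cu≡k refl = just≢nothing cu≡k v-uncolored

  -- Case (1): no colored vertex is changed, so every b-vertex still sees what it saw before.
  extend-by-missing-color : ∀ k → ¬ Sees G c v k →
                            ∃ λ (e : Extension G c) → Colored (coloring e) v
  extend-by-missing-color k ¬vk =
    extension c′
      ( recolor-proper c v k G proper (λ {u} _ cu≡k vu → ¬vk (u , vu , cu≡k))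
      , λ l → b l , keep (b-color l) , λ d d≢l →
          let (u , bu , cu≡d) = b-sees l d d≢l in u , bu , keep cu≡d)
      ≤-refl (recolor-colored c v k)
    , k , recolor-same c v k
    where
    c′ : PartialColoring n t
    c′ = recolor c v k

    keep : ∀ {u l} → c u ≡ just l → c′ u ≡ just l
    keep cu≡l = recolor-other c v k (colored≢v cu≡l) cu≡l

  -- Case (2): the old colors are shifted by `suc`, which frees `zero` for `v`. The vertex `v` sees
  -- all old colors, and the b-vertices adjacent to `v` see `zero` there.
  extend-by-new-color : (∀ k → Sees G c v k) →
                        (∀ k → ∃ λ u → IsPartialBVertex G c u k × Adj G v u) →
                        ∃ λ (e : Extension G c) → Colored (coloring e) v
  extend-by-new-color v-sees bAdj =
    extension c′
      ( recolor-proper (map suc ∘ c) v zero G map-proper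
          (λ {u} _ eq → contradiction eq (map-suc≢zero {m = c u}))
      , b′)
      (n≤1+n t) (λ (k , cu≡k) → suc k , keep cu≡k)
    , zero , recolor-same (map suc ∘ c) v zero
    where
    c′ : PartialColoring n (ℕ.suc t)
    c′ = recolor (map suc ∘ c) v zero

    keep : ∀ {u l} → c u ≡ just l → c′ u ≡ just (suc l)
    keep cu≡l = recolor-other (map suc ∘ c) v zero (colored≢v cu≡l) (map-just cu≡l)

    map-proper : IsPartialProper G (map suc ∘ c)
    map-proper {u} {k = zero}  uw eq eq′ = map-suc≢zero {m = c u} eq
    map-proper {k = suc k} uw eq eq′ = proper uw (map-suc⁻ eq) (map-suc⁻ eq′)

    b′ : ∀ k → ∃ λ u → IsPartialBVertex G c′ u k
    b′ zero = v , recolor-same (map suc ∘ c) v zero , λ where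
      zero    0≢0 → contradiction refl 0≢0
      (suc d) _   → let (u , vu , cu≡d) = v-sees d in u , vu , keep cu≡d
    b′ (suc k) =
      let (w , (cw≡k , w-sees) , vw) = bAdj k in
      w , keep cw≡k , λ where
        zero    _   → v , symm G vw , recolor-same (map suc ∘ c) v zero
        (suc d) d≢k → let (u , wu , cu≡d) = w-sees d (d≢k ∘ cong suc)
                      in  u , wu , keep cu≡d

  -- Case (3): `y` moves to the color `d` that it misses, and `v` takes over `k`. No chosen b-vertex
  -- `b l` is `y`, so all of them keep their colors.
  extend-by-swap : ∀ {k d y} → d ≢ k → ¬ Adj G v (b k) → c y ≡ just k → y ≢ b k →
                   ¬ Sees G c y d →
                   ∃ λ (e : Extension G c) → Colored (coloring e) v
  extend-by-swap {k} {d} {y} d≢k ¬vx cy≡k y≢x ¬yd =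
    extension c₂
      ( recolor-proper c₁ v k G
          (recolor-proper c y d G proper (λ {u} _ cu≡d yu → ¬yd (u , yu , cu≡d)))
          free
      , λ l → b l , keep (b-color l) (b≢y l) , b-sees′ l)
      ≤-refl (recolor-colored c₁ v k ∘ recolor-colored c y d)
    , k , recolor-same c₁ v k
    where
    x : Fin n
    x = b k

    c₁ c₂ : PartialColoring n t
    c₁ = recolor c y d
    c₂ = recolor c₁ v k

    keep : ∀ {u l} → c u ≡ just l → u ≢ y → c₂ u ≡ just l
    keep cu≡l u≢y =
      recolor-other c₁ v k (colored≢v cu≡l) (recolor-other c y d u≢y cu≡l)

    sameColor⇒¬adj : ∀ {p q} → c p ≡ just k → c q ≡ just k → ¬ Adj G p q
    sameColor⇒¬adj cp≡k cq≡k pq = proper pq cp≡k cq≡k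

    b≢y : ∀ l → b l ≢ y
    b≢y l refl with just-injective (trans (sym (b-color l)) cy≡k)
    ... | refl = y≢x refl

    -- Once `y` has left, only `x` has color `k`: a third vertex of the old class would form a
    -- stable triple with `x` and `y`.
    free : ∀ {u} → u ≢ v → c₁ u ≡ just k → ¬ Adj G v u
    free {u} _ c₁u≡k vu with u ≟ x | u ≟ y
    ... | yes refl | _        = ¬vx vu
    ... | no u≢x   | no u≢y   = sameColor⇒¬adj cy≡k cu≡k
      (α≤2 (y≢x ∘ sym) (u≢x ∘ sym) (u≢y ∘ sym)
           (sameColor⇒¬adj (b-color k) cy≡k) (sameColor⇒¬adj (b-color k) cu≡k))
      where
      cu≡k : c u ≡ just k
      cu≡k = recolor-other⁻ c y d u≢y c₁u≡k
    ... | no _     | yes refl =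
      d≢k (just-injective (trans (sym (recolor-same c y d)) c₁u≡k))

    b-sees′ : ∀ l e → e ≢ l → Sees G c₂ (b l) e
    b-sees′ l e e≢l with b-sees l e e≢l
    ... | u , bu , cu≡e with u ≟ y
    ...   | no u≢y = u , bu , keep cu≡e u≢y
    -- A color is lost only if it was seen at `y`, so it is `k`; a replacement must be `x` or `v`.
    ...   | yes refl with just-injective (trans (sym cu≡e) cy≡k) | adj? G (b l) x
    ...     | refl | yes bx = x , bx , keep (b-color k) (b≢y k)
    -- Here `x` is adjacent to neither `v` nor `b l`, so these two are adjacent to each other.
    ...     | refl | no ¬bx =
      v , symm G (α≤2 x≢v x≢b (colored≢v (b-color l) ∘ sym) (¬vx ∘ symm G) (¬bx ∘ symm G))
        , recolor-same c₁ v k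
      where
      x≢v : x ≢ v
      x≢v = colored≢v (b-color k)

      x≢b : x ≢ b l
      x≢b x≡b = e≢l (just-injective
        (trans (sym (b-color k)) (trans (cong c x≡b) (b-color l))))

  extend-uncolored : ∃ λ (e : Extension G c) → Colored (coloring e) v
  extend-uncolored with all? (sees? G c v)
  ... | no ¬all with ¬∀⟶∃¬ _ _ (sees? G c v) ¬all
  ...   | k , ¬vk = extend-by-missing-color k ¬vk
  extend-uncolored | yes v-sees
    with all? (λ k → any? λ u → isPartialBVertex? G c u k ×-dec adj? G v u)
  ... | yes bAdj = extend-by-new-color v-sees bAdj
  ... | no ¬all
    with ¬∀⟶∃¬ _ _ (λ k → any? λ u → isPartialBVertex? G c u k ×-dec adj? G v u) ¬all
  ...   | k , ¬bAdj with v-sees k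
  ...     | y , vy , cy≡k
    -- As a neighbor of `v` with color `k`, `y` cannot be a b-vertex, so it misses some color other
    -- than `k`.
    with ¬∀⟶∃¬ _ _ (λ d → ¬? (d ≟ k) →-dec sees? G c y d)
               (λ y-sees → ¬bAdj (y , (cy≡k , y-sees) , vy))
  ...       | d , ¬yd =
    -- The failed implication `¬yd` gives both `d ≢ k` and that `y` misses `d`. Adjacency to `v`
    -- tells `y` apart from `b k`.
    extend-by-swap (λ d≡k → ¬yd (contradiction d≡k)) ¬vx cy≡k (λ { refl → ¬vx vy })
                   (λ yd → ¬yd (const yd))
    where
    ¬vx : ¬ Adj G v (b k)
    ¬vx vx = ¬bAdj (b k , proj₂ (proj₂ bcol k) , vx)

-- Coloring the remaining vertices one at a time.

extend-all : (G : Graph n) → NoStableTriple G → (vs : List (Fin n))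
             (c : PartialColoring n t) → IsPartialBColoring G c →
             ∃ λ (e : Extension G c) → ∀ {u} → u ∈ˡ vs → Colored (coloring e) u
extend-all G α≤2 [] c bcol = extension c bcol ≤-refl (λ p → p) , λ ()
extend-all {n} {t} G α≤2 (v ∷ vs) c bcol with extend-v
  where
  extend-v : ∃ λ (e : Extension G c) → Colored (coloring e) v
  extend-v with c v in cv
  ... | just k  = extension c bcol ≤-refl (λ p → p) , k , cv
  ... | nothing = extend-uncolored G α≤2 c bcol v cv
... | e , v-colored with extend-all G α≤2 vs (coloring e) (bColoring e)
...   | e′ , vs-colored =
  extension (coloring e′) (bColoring e′) (≤-trans (moreColors e) (moreColors e′))
            (extends e′ ∘ extends e)
  -- Later extensions may change the color of `v` but never remove it.
  , λ { (here refl) → extends e′ v-colored ; (there u∈vs) → vs-colored u∈vs }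

-- Passage between partial and ordinary b-colorings.

totalize : (G : Graph n) (c : PartialColoring n t) → IsPartialBColoring G c →
           (∀ u → Colored c u) → HasBColoring G t
totalize {n} {t} G c (proper , b) total =
  c′ , (λ u v uv eq → proper uv (color u) (trans (color v) (cong just (sym eq)))) ,
  λ k → let (v , cv≡k , v-sees) = b k in
    v , c′≡ cv≡k , λ d d≢c′v →
      let (u , vu , cu≡d) = v-sees d (λ d≡k → d≢c′v (trans d≡k (sym (c′≡ cv≡k))))
      in  u , vu , c′≡ cu≡d
  where
  c′ : Fin n → Fin t
  c′ u = proj₁ (total u)

  color : ∀ u → c u ≡ just (c′ u)
  color u = proj₂ (total u)

  c′≡ : ∀ {u k} → c u ≡ just k → c′ u ≡ k
  c′≡ {u} cu≡k = just-injective (trans (sym (color u)) cu≡k)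

induced⇒partial : (G : Graph n) (S : Subset n) → HasBColoring (G [ S ]) t →
                  ∃ λ (c : PartialColoring n t) → IsPartialBColoring G c
induced⇒partial {n} {t} G S (c , proper , b) = c′ ,
  (λ {u} {v} uv c′u≡k c′v≡k → proper′ uv (c′⁻ u c′u≡k) (c′⁻ v c′v≡k)) ,
  λ k → let (i , ci≡k , i-sees) = b k in
    element S i , c′-element ci≡k , λ d d≢k →
      let (j , ij , cj≡d) = i-sees d (λ d≡ci → d≢k (trans d≡ci ci≡k))
      in  element S j , ij , c′-element cj≡d
  where
  c′ : PartialColoring n t
  c′ u with u ∈? S
  ... | yes u∈S = just (c (proj₁ (element-surjective S u∈S)))
  ... | no _    = nothing

  c′-element : ∀ {i k} → c i ≡ k → c′ (element S i) ≡ just k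
  c′-element {i} ci≡k with element S i ∈? S
  ... | no ∉S  = contradiction (element-∈ S i) ∉S
  ... | yes ∈S = cong just (trans
    (cong c (element-injective S (proj₂ (element-surjective S ∈S)))) ci≡k)

  -- Every colored vertex comes from an index of the induced subgraph; this reduces properness of
  -- `c′` to that of `c`.
  c′⁻ : ∀ u {k} → c′ u ≡ just k → ∃ λ i → element S i ≡ u × c i ≡ k
  c′⁻ u eq with u ∈? S
  ... | yes u∈S = let (i , Si≡u) = element-surjective S u∈S
                  in  i , Si≡u , just-injective eq

  proper′ : ∀ {u v k} → Adj G u v → (∃ λ i → element S i ≡ u × c i ≡ k) →
            ¬ (∃ λ i → element S i ≡ v × c i ≡ k)
  proper′ uv (i , refl , ci≡k) (j , refl , cj≡k) = proper i j uv (trans ci≡k (sym cj≡k))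

-- Comparison of b-chromatic numbers.

χb-induced≤ : (G : Graph n) → NoStableTriple G → ∀ S → χb (G [ S ]) ≤ χb G
χb-induced≤ {n} G α≤2 S
  with induced⇒partial G S (proj₁ (proj₂ (χb-maximum (G [ S ]))))
... | c , bcol with extend-all G α≤2 (allFin n) c bcol
...   | e , total = ≤-trans (moreColors e)
  (proj₂ (proj₂ (χb-maximum G)) _
    (totalize G (coloring e) (bColoring e) (λ u → total (∈-allFin u))))

theorem6 : ∀ (n : ℕ) (G : Graph n) → stability G ≤ 2 → IsBMonotonic G
theorem6 n G α≤2 S₁ =
  -- The larger subgraph takes the place of the whole graph, as the triple condition passes to
  -- induced subgraphs.
  χb-induced≤ (G [ S₁ ])
    (noStableTriple-induced G S₁ (stability≤2⇒noStableTriple G α≤2))
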